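{- Let $(N_1,m_1)$ and $(N_2,m_2)$ be labeled marked Petri nets, with place sets $P_1=\{p^1_1,\dots,p^1_k\}$ and $P_2=\{p^2_1,\dots,p^2_l\}$, and let $E$ be a system of linear constraints such that $(N_1,m_1)\vartriangleright_E(N_2,m_2)$. Let $F_1$ be a formula with $(\mathrm{fv}(F_1)\setminus P_1)\cap(\mathrm{fv}(E)\setminus P_1)=\emptyset$, and let $F_2(\vec y)\triangleq\exists\vec x.\ \tilde E(\vec x,\vec y)\wedge F_1(\vec x)$ be its $E$-transform. Then $F_1$ is reachable in $(N_1,m_1)$ if and only if there exists $j\ge0$ such that $F_2(\vec y_j)\wedge\phi_j(N_2,m_2)$ is satisfiable.
   Context: A Petri net $N=(P,T,\mathrm{Pre},\mathrm{Post})$ has a finite set of places $P$, a finite set of transitions $T$ disjoint from $P$, and flow functions $\mathrm{Pre},\mathrm{Post}:T\to(P\to\mathbb N)$. A marking is a map $m:P\to\mathbb N$; a marked net is a pair $(N,m)$. Transition $t$ is enabled at $m$ if $m(p)\ge\mathrm{Pre}(t,p)$ for all $p$; firing it yields $m'=m-\mathrm{Pre}(t)+\mathrm{Post}(t)$, written $m\xrightarrow{t}m'$. A firing sequence $\varrho=t_1\cdots t_n$ is fired from $m$ to $m'$ ($m\overset{\varrho}{\Rightarrow}m'$) if there are markings $m=m_0,\dots,m_n=m'$ with $m_i\xrightarrow{t_{i+1}}m_{i+1}$. $R(N,m_0)$ is the set of markings reachable from $m_0$. A labeled net has a labeling $l:T\to\Sigma\cup\{\tau\}$ ($\tau\notin\Sigma$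 silent), extended to sequences by $l(\epsilon)=\epsilon$, $\tau$ mapped to $\epsilon$, $l(\varrho t)=l(\varrho)l(t)$. Formulas are Boolean combinations of linear (in)equalities over integer variables; place names are used as variables. For a marking $m$ over $P=\{p_1,\dots,p_n\}$, $\underline m(\vec z)\triangleq\bigwedge_i(z_i=m(p_i))$ (with $\underline m=\underline m(\vec p)$). $m\models\phi$ means $\phi\wedge\underline m$ is satisfiable over the integers. $\phi$ is reachable in $(N,m_0)$ if some $m\in R(N,m_0)$ has $m\models\phi$. Markings $m_1$ over $P_1$, $m_2$ over $P_2$ are compatible if they agree on $P_1\cap P_2$; $m_1\uplus m_2$ is then the marking over $P_1\cup P_2$ agreeing with both; $m_1\uplus m_2\models E$ presupposes compatibility. $E$-abstraction: for labeled nets $N_1,N_2$ (labelings $l_1,l_2$ over the same $\Sigma$) and a system $E$ of linear constraints (possibly with variables outside $P_1\cup P_2$), $(N_1,m_1)\sqsupseteq_E(N_2,m_2)$ iff (A1) $m_1\uplus m_2\models E$; and (A2) for every firing sequence $m_1\overset{\varrho_1}{\Rightarrow}m_1'$ in $N_1$ there is at least one marking $m_2'$ over $P_2$ with $m_1'\uplus m_2'\models E$, and for every marking $m_2'$ over $P_2$ with $m_1'\uplus m_2'\models E$ there is a firing sequence $\varrho_2$ of $N_2$ with $m_2\overset{\varrho_2}{\Rightarrow}m_2'$ and $l_1(\varrho_1)=l_2(\varrho_2)$. $(N_1,m_1)\vartriangleright_E(N_2,m_2)$ means both $(N_1,m_1)\sqsupseteq_E(N_2,m_2)$ and $(N_2,m_2)\sqsupseteq_E(N_1,m_1)$.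 $E$-transform: with $\vec p_1=(p^1_1,\dots,p^1_k)$, $\vec p_2=(p^2_1,\dots,p^2_l)$ and disjoint variable vectors $\vec x,\vec y$, $\tilde E(\vec x,\vec y)\triangleq E\{\vec p_1\leftarrow\vec x\}\{\vec p_2\leftarrow\vec y\}\wedge\bigwedge_{\{(i,j)\mid p^1_i=p^2_j\}}(x_i=y_j)$; $F_1(\vec x)$ is $F_1$ with $p^1_i$ replaced by $x_i$. BMC formulas: for a net $N$ with places $p_1,\dots,p_n$ and variable vectors $\vec z,\vec z'$, let $\mathrm{ENBL}_t(\vec z)\triangleq\bigwedge_i z_i\ge\mathrm{Pre}(t,p_i)$, $\Delta_t(\vec z,\vec z')\triangleq\bigwedge_i z_i'=z_i+\mathrm{Post}(t,p_i)-\mathrm{Pre}(t,p_i)$, $\mathrm{EQ}(\vec z,\vec z')\triangleq\bigwedge_i z_i=z_i'$, and $\mathrm{T}(\vec z,\vec z')\triangleq\mathrm{EQ}(\vec z,\vec z')\vee\bigvee_{t\in T}(\mathrm{ENBL}_t(\vec z)\wedge\Delta_t(\vec z,\vec z'))$. Given pairwise disjoint vectors of variables $\vec y_0,\vec y_1,\dots$ (each of length $l$) for $N_2$, define $\phi_0(N_2,m_2)\triangleq\underline{m_2}(\vec y_0)$ and $\phi_{i+1}(N_2,m_2)\triangleq\phi_i(N_2,m_2)\wedge\mathrm{T}_2(\vec y_i,\vec y_{i+1})$, where $\mathrm{T}_2$ is $\mathrm{T}$ for $N_2$.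
   Formalization: The E-transform F₂ has the added conjunct that every x_i ≥ 0; with x ranging over all integers the claim fails (N₁ one empty place p, N₂ empty, no transitions, E: p ≤ 0, F₁: p ≠ 0, x = −1). -}

module Defs where

open import Data.Bool using (if_then_else_)
open import Data.Empty as Empty using ()
open import Data.Fin using (Fin)
open import Data.Fin.Properties using (any?)
open import Data.Integer as ℤ using (ℤ; +_; 0ℤ)
open import Data.List using (List; []; _∷_; foldr; map; mapMaybe)
open import Data.Maybe using (Maybe)
open import Data.Nat using (ℕ; zero; suc; _≥_; _∸_; _+_)
open import Data.Product using (Σ; ∃; ∃-syntax; _×_; _,_; proj₁; uncurry)
open import Data.Sum using (_⊎_)
open import Data.Unit as Unit using ()
open import Data.Vec.Functional as Vector using (Vector; _++_)
open import Function.Definitions using (Injective)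
open import Level using (0ℓ)
open import Relation.Binary.Definitions using (DecidableEquality)
open import Relation.Binary.PropositionalEquality using (_≡_; _≗_)
open import Relation.Nullary using (¬_; yes; no; ⌊_⌋)
open import Relation.Unary using (Pred; ∅; ｛_｝; _∪_; _∉_; Satisfiable)
  renaming (_⊥_ to Disjoint)

private
  variable
    V L : Set
    n k l : ℕ

------------------------------------------------------------------------
-- Linear arithmetic over integer variables named by V

infixl 7 _⊕_
infixr 8 _·_
infix  6 _≐_ _≼_ _≺_ _≽_
infixr 5 _∧_ _∧′_
infixr 4 _∨_

data Term (V : Set) : Set where
  var   : V → Term V
  const : ℤ → Term V
  _⊕_   : Term V → Term V → Term V
  _·_   : ℤ → Term V → Term V

data Constraint (V : Set) : Set where
  _≐_ _≼_ _≺_ : Term V → Term V → Constraint V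

_≽_ : Term V → Term V → Constraint V
s ≽ t = t ≼ s

data Formula (V : Set) : Set where
  atom    : Constraint V → Formula V
  ⊤ ⊥     : Formula V
  ~_      : Formula V → Formula V
  _∧_ _∨_ : Formula V → Formula V → Formula V

-- Only E-transforms need quantifiers, so formulas proper stay
-- quantifier-free and the existential quantifier is a layer on top.
data ExFormula (V : Set) : Set where
  qf    : Formula V → ExFormula V
  _∧′_  : ExFormula V → ExFormula V → ExFormula V
  ∃[_]′_ : Vector V k → ExFormula V → ExFormula V

⋀ ⋁ : Vector (Formula V) n → Formula V
⋀ = Vector.foldr _∧_ ⊤
⋁ = Vector.foldr _∨_ ⊥

System : Set → Set
System V = List (Constraint V)

conj : System V → Formula V
conj E = foldr _∧_ ⊤ (map atom E)

------------------------------------------------------------------------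
-- Semantics

Valuation : Set → Set
Valuation V = V → ℤ

⟦_⟧ₜ : Term V → Valuation V → ℤ
⟦ var x ⟧ₜ   v = v x
⟦ const c ⟧ₜ v = c
⟦ s ⊕ t ⟧ₜ   v = ⟦ s ⟧ₜ v ℤ.+ ⟦ t ⟧ₜ v
⟦ c · t ⟧ₜ   v = c ℤ.* ⟦ t ⟧ₜ v

⟦_⟧ᶜ : Constraint V → Pred (Valuation V) 0ℓ
⟦ s ≐ t ⟧ᶜ v = ⟦ s ⟧ₜ v ≡ ⟦ t ⟧ₜ v
⟦ s ≼ t ⟧ᶜ v = ⟦ s ⟧ₜ v ℤ.≤ ⟦ t ⟧ₜ v
⟦ s ≺ t ⟧ᶜ v = ⟦ s ⟧ₜ v ℤ.< ⟦ t ⟧ₜ v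

⟦_⟧ : Formula V → Pred (Valuation V) 0ℓ
⟦ atom c ⟧ v = ⟦ c ⟧ᶜ v
⟦ ⊤ ⟧      v = Unit.⊤
⟦ ⊥ ⟧      v = Empty.⊥
⟦ ~ φ ⟧    v = ¬ ⟦ φ ⟧ v
⟦ φ ∧ ψ ⟧  v = ⟦ φ ⟧ v × ⟦ ψ ⟧ v
⟦ φ ∨ ψ ⟧  v = ⟦ φ ⟧ v ⊎ ⟦ ψ ⟧ v

Range : Vector V n → Pred V 0ℓ
Range xs z = ∃[ i ] xs i ≡ z

⟦_⟧∃ : ExFormula V → Pred (Valuation V) 0ℓ
⟦ qf φ ⟧∃      v = ⟦ φ ⟧ v
⟦ φ ∧′ ψ ⟧∃    v = ⟦ φ ⟧∃ v × ⟦ ψ ⟧∃ v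
⟦ ∃[ xs ]′ φ ⟧∃ v =
  Σ (Valuation _) λ w → (∀ z → z ∉ Range xs → w z ≡ v z) × ⟦ φ ⟧∃ w

------------------------------------------------------------------------
-- Free variables and substitution of variables for variables

fvₜ : Term V → Pred V 0ℓ
fvₜ (var x)   = ｛ x ｝
fvₜ (const c) = ∅
fvₜ (s ⊕ t)   = fvₜ s ∪ fvₜ t
fvₜ (c · t)   = fvₜ t

fvᶜ : Constraint V → Pred V 0ℓ
fvᶜ (s ≐ t) = fvₜ s ∪ fvₜ t
fvᶜ (s ≼ t) = fvₜ s ∪ fvₜ t
fvᶜ (s ≺ t) = fvₜ s ∪ fvₜ t

fv : Formula V → Pred V 0ℓ
fv (atom c) = fvᶜ c
fv ⊤        = ∅
fv ⊥        = ∅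
fv (~ φ)    = fv φ
fv (φ ∧ ψ)  = fv φ ∪ fv ψ
fv (φ ∨ ψ)  = fv φ ∪ fv ψ

renameₜ : (V → V) → Term V → Term V
renameₜ σ (var x)   = var (σ x)
renameₜ σ (const c) = const c
renameₜ σ (s ⊕ t)   = renameₜ σ s ⊕ renameₜ σ t
renameₜ σ (c · t)   = c · renameₜ σ t

renameᶜ : (V → V) → Constraint V → Constraint V
renameᶜ σ (s ≐ t) = renameₜ σ s ≐ renameₜ σ t
renameᶜ σ (s ≼ t) = renameₜ σ s ≼ renameₜ σ t
renameᶜ σ (s ≺ t) = renameₜ σ s ≺ renameₜ σ t

rename : (V → V) → Formula V → Formula V
rename σ (atom c) = atom (renameᶜ σ c)
rename σ ⊤        = ⊤
rename σ ⊥        = ⊥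
rename σ (~ φ)    = ~ rename σ φ
rename σ (φ ∧ ψ)  = rename σ φ ∧ rename σ ψ
rename σ (φ ∨ ψ)  = rename σ φ ∨ rename σ ψ

-- [ ps ← xs ] is meant for ps without repetitions.
module Substitution (_≟_ : DecidableEquality V) where

  [_←_] : Vector V n → Vector V n → V → V
  [ ps ← xs ] z with any? (λ i → ps i ≟ z)
  ... | yes (i , _) = xs i
  ... | no  _       = z

  infixl 9 _⟪_←_⟫
  _⟪_←_⟫ : Formula V → Vector V n → Vector V n → Formula V
  φ ⟪ ps ← xs ⟫ = rename [ ps ← xs ] φ

------------------------------------------------------------------------
-- Labeled Petri nets.  Places are variables, listed without repetition;
-- transitions are indices, hence disjoint from places.  Two nets share
-- the places whose names coincide.

record LabeledNet (V L : Set) : Set where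
  field
    #P #T       : ℕ
    place       : Vector V #P
    place-inj   : Injective _≡_ _≡_ place
    Pre Post    : Fin #T → Fin #P → ℕ
    label       : Fin #T → Maybe L   -- nothing is the silent label τ

  Marking : Set
  Marking = Vector ℕ #P

  Transition : Set
  Transition = Fin #T

  Enabled : Marking → Transition → Set
  Enabled m t = ∀ p → m p ≥ Pre t p

  _—[_]→_ : Marking → Transition → Marking → Set
  m —[ t ]→ m′ = Enabled m t × (∀ p → m′ p ≡ (m p ∸ Pre t p) + Post t p)

  -- Markings are compared pointwise, as no extensionality is assumed.
  data _⟹[_]_ : Marking → List Transition → Marking → Set where
    ε   : ∀ {m m′} → m ≗ m′ → m ⟹[ [] ] m′
    _◅_ : ∀ {m m′ m″ t ϱ} → m —[ t ]→ m′ → m′ ⟹[ ϱ ] m″ → m ⟹[ t ∷ ϱ ] m″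

  observe : List Transition → List L
  observe = mapMaybe label

open LabeledNet public using (#P; place; Marking)

MarkedNet : Set → Set → Set
MarkedNet V L = ∃[ N ] Marking {V} {L} N

R : (M : MarkedNet V L) → Pred (Marking (proj₁ M)) 0ℓ
R (N , m₀) m = ∃[ ϱ ] m₀ ⟹[ ϱ ] m
  where open LabeledNet N using (_⟹[_]_)

------------------------------------------------------------------------
-- Markings as formulas

-- The formula z₁ = m(p₁) ∧ … ∧ zₙ = m(pₙ)
⌜_⌝ : Vector ℕ n → Vector V n → Formula V
⌜ m ⌝ z = ⋀ λ i → atom (var (z i) ≐ const (+ m i))

infix 3 _at_⊨_
_at_⊨_ : Vector ℕ n → Vector V n → Formula V → Set
m at ps ⊨ φ = Satisfiable ⟦ φ ∧ ⌜ m ⌝ ps ⟧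

ReachableFormula : Formula V → MarkedNet V L → Set
ReachableFormula φ M@(N , _) = ∃[ m ] R M m × (m at place N ⊨ φ)

module _ (N₁ N₂ : LabeledNet V L) where

  Compatible : Marking N₁ → Marking N₂ → Set
  Compatible m₁ m₂ = ∀ i j → place N₁ i ≡ place N₂ j → m₁ i ≡ m₂ j

  -- m₁ ⊎ m₂ ⊨ E.  The concatenated place vector enumerates P₁ ∪ P₂, a
  -- shared place occurring twice, with one value by compatibility.
  Joint⊨ : System V → Marking N₁ → Marking N₂ → Set
  Joint⊨ E m₁ m₂ =
    Compatible m₁ m₂ × (m₁ ++ m₂ at place N₁ ++ place N₂ ⊨ conj E)

------------------------------------------------------------------------
-- E-abstraction and E-equivalence

infix 3 _⊒[_]_ _▷[_]_

record _⊒[_]_ (M₁ : MarkedNet V L) (E : System V) (M₂ : MarkedNet V L) : Set where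
  open Σ M₁ renaming (proj₁ to N₁; proj₂ to m₁)
  open Σ M₂ renaming (proj₁ to N₂; proj₂ to m₂)
  module N₁ = LabeledNet N₁
  module N₂ = LabeledNet N₂
  field
    A1  : Joint⊨ N₁ N₂ E m₁ m₂
    A2∃ : ∀ {ϱ₁ m₁′} → m₁ N₁.⟹[ ϱ₁ ] m₁′ → ∃[ m₂′ ] Joint⊨ N₁ N₂ E m₁′ m₂′
    A2∀ : ∀ {ϱ₁ m₁′} → m₁ N₁.⟹[ ϱ₁ ] m₁′ →
          ∀ m₂′ → Joint⊨ N₁ N₂ E m₁′ m₂′ →
          ∃[ ϱ₂ ] m₂ N₂.⟹[ ϱ₂ ] m₂′ × N₁.observe ϱ₁ ≡ N₂.observe ϱ₂

_▷[_]_ : MarkedNet V L → System V → MarkedNet V L → Set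
M₁ ▷[ E ] M₂ = (M₁ ⊒[ E ] M₂) × (M₂ ⊒[ E ] M₁)

------------------------------------------------------------------------
-- E-transform

module _ (_≟_ : DecidableEquality V) (N₁ N₂ : LabeledNet V L) where
  open Substitution _≟_

  Ẽ : System V → Vector V (#P N₁) → Vector V (#P N₂) → Formula V
  Ẽ E x y = conj E ⟪ place N₁ ← x ⟫ ⟪ place N₂ ← y ⟫
          ∧ ⋀ λ i → ⋀ λ j →
              if ⌊ place N₁ i ≟ place N₂ j ⌋ then atom (var (x i) ≐ var (y j)) else ⊤

  -- The variables x stand for places of N₁, so they range over ℕ.  This
  -- has to be said: for a single place p without transitions, initially
  -- empty, a net N₂ without places, E = (p ≤ 0) and F₁ = ¬ (p = 0), the
  -- value x = -1 satisfies Ẽ ∧ F₁(x) although F₁ is not reachable.  No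
  -- such conjunct is needed for y: φ below forces it to be nonnegative.
  E-transform : System V → Formula V →
                Vector V (#P N₁) → Vector V (#P N₂) → ExFormula V
  E-transform E F₁ x y =
    ∃[ x ]′ qf ((⋀ λ i → atom (var (x i) ≽ const 0ℤ))
                ∧ Ẽ E x y ∧ F₁ ⟪ place N₁ ← x ⟫)

------------------------------------------------------------------------
-- Bounded model checking

module _ (N : LabeledNet V L) where
  open LabeledNet N using (Transition; Pre; Post)

  ENBL : Transition → Vector V (#P N) → Formula V
  ENBL t z = ⋀ λ i → atom (var (z i) ≽ const (+ Pre t i))

  Δ : Transition → (z z′ : Vector V (#P N)) → Formula V
  Δ t z z′ = ⋀ λ i →
    atom (var (z′ i) ≐ var (z i) ⊕ const (+ Post t i ℤ.- + Pre t i))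

  EQ : (z z′ : Vector V (#P N)) → Formula V
  EQ z z′ = ⋀ λ i → atom (var (z i) ≐ var (z′ i))

  T : (z z′ : Vector V (#P N)) → Formula V
  T z z′ = EQ z z′ ∨ ⋁ λ t → ENBL t z ∧ Δ t z z′

φ : (M : MarkedNet V L) → (ℕ → Vector V (#P (proj₁ M))) → ℕ → Formula V
φ (N , m) y zero    = ⌜ m ⌝ (y zero)
φ (N , m) y (suc i) = φ (N , m) y i ∧ T N (y i) (y (suc i))

-- x, y 0, y 1, … consist of distinct variables, none of them in use.
record Fresh (used : Pred V 0ℓ) (x : Vector V k) (y : ℕ → Vector V l) : Set where
  field
    x-distinct : Injective _≡_ _≡_ x
    y-distinct : Injective _≡_ _≡_ (uncurry y)
    x-y        : ∀ i → Disjoint (Range x) (Range (y i))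
    x-fresh    : Disjoint (Range x) used
    y-fresh    : ∀ i → Disjoint (Range (y i)) used

{-# OPTIONS --safe #-}
-- A reachable marking m of N₁ satisfying F₁ has an E-partner m′ reachable in
-- N₂; a run to m′ is a model of φ j for j its length, and gluing it with the
-- models of F₁ and E is possible because outside P₁ these two share no variable.
-- Conversely, a model of φ j is a run of N₂ with stuttering; its last marking is
-- E-related to the value of x, so N₂ ⊒ N₁ makes that value reachable in N₁.
module Submission where

open import Data.Bool using (if_then_else_)
open import Data.Empty using (⊥-elim)
open import Data.Fin using (Fin; zero; suc; toℕ; fromℕ<; splitAt; _↑ˡ_; _↑ʳ_)
open import Data.Fin.Properties using (any?; toℕ-injective; toℕ-fromℕ<)
open import Data.Integer as ℤ using (ℤ; +_; 0ℤ; ∣_∣)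
import Data.Integer.Properties as ℤ
open import Data.List using ([]; _∷ʳ_; length)
open import Data.Nat using (ℕ; zero; suc; z≤n; s≤s; _≤_; _∸_; _+_)
import Data.Nat.Properties as ℕ
open import Data.Product using (_×_; _,_; _,′_; ∃-syntax)
open import Data.Product.Properties using (,-injectiveˡ; ,-injectiveʳ)
open import Data.Sum using (inj₁; inj₂)
import Data.Sum as Sum
open import Data.Vec.Functional using (Vector; _++_)
open import Data.Vec.Functional.Properties using (lookup-++ˡ; lookup-++ʳ)
open import Function.Base using (_∘_; case_of_)
open import Function.Bundles using (_⇔_; mk⇔)
open import Function.Definitions using (Injective)
open import Relation.Binary.Definitions using (DecidableEquality)
open import Relation.Binary.PropositionalEquality
  using (_≡_; _≗_; refl; sym; trans; cong; cong₂; subst; subst₂; module ≡-Reasoning)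
open import Relation.Nullary using (¬_; Dec; yes; no; ⌊_⌋)
open import Relation.Nullary.Decidable using (map′; _⊎-dec_)
open import Relation.Unary using (_∪_; _∩_; _∖_; _∉_; Empty; Satisfiable; Decidable)
open import Defs

open ≡-Reasoning

private
  variable
    A V L : Set
    n k l : ℕ
    u v : Valuation V

-- Finite conjunctions, disjunctions and guarded formulas under a valuation.

⋀-intro : (f : Vector (Formula V) n) → (∀ i → ⟦ f i ⟧ v) → ⟦ ⋀ f ⟧ v
⋀-intro {n = zero}  f h = _
⋀-intro {n = suc n} f h = h zero , ⋀-intro (f ∘ suc) (h ∘ suc)

⋀-elim : (f : Vector (Formula V) n) → ⟦ ⋀ f ⟧ v → ∀ i → ⟦ f i ⟧ v
⋀-elim f (h , _)  zero    = h
⋀-elim f (_ , hs) (suc i) = ⋀-elim (f ∘ suc) hs i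

⋁-intro : (f : Vector (Formula V) n) → ∃[ i ] ⟦ f i ⟧ v → ⟦ ⋁ f ⟧ v
⋁-intro f (zero  , h) = inj₁ h
⋁-intro f (suc i , h) = inj₂ (⋁-intro (f ∘ suc) (i , h))

⋁-elim : (f : Vector (Formula V) n) → ⟦ ⋁ f ⟧ v → ∃[ i ] ⟦ f i ⟧ v
⋁-elim {n = suc n} f (inj₁ h) = zero , h
⋁-elim {n = suc n} f (inj₂ h) with ⋁-elim (f ∘ suc) h
... | i , hᵢ = suc i , hᵢ

guard-intro : {P : Set} (P? : Dec P) (ψ : Formula V) →
              (P → ⟦ ψ ⟧ v) → ⟦ if ⌊ P? ⌋ then ψ else ⊤ ⟧ v
guard-intro (yes p) ψ h = h p
guard-intro (no _)  ψ h = _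

guard-elim : {P : Set} (P? : Dec P) (ψ : Formula V) →
             ⟦ if ⌊ P? ⌋ then ψ else ⊤ ⟧ v → P → ⟦ ψ ⟧ v
guard-elim (yes _) ψ h p = h
guard-elim (no ¬p) ψ h p = ⊥-elim (¬p p)

-- Evaluation under renaming of variables.

rename-evalₜ : ∀ (σ : V → V) t → (∀ {z} → fvₜ t z → u z ≡ v (σ z)) →
               ⟦ t ⟧ₜ u ≡ ⟦ renameₜ σ t ⟧ₜ v
rename-evalₜ σ (var z)   h = h refl
rename-evalₜ σ (const c) h = refl
rename-evalₜ σ (s ⊕ t)   h =
  cong₂ ℤ._+_ (rename-evalₜ σ s (h ∘ inj₁)) (rename-evalₜ σ t (h ∘ inj₂))
rename-evalₜ σ (c · t)   h = cong (c ℤ.*_) (rename-evalₜ σ t h)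

module _ (σ : V → V) where

  rename-introᶜ : ∀ c → (∀ {z} → fvᶜ c z → u z ≡ v (σ z)) →
                  ⟦ c ⟧ᶜ u → ⟦ renameᶜ σ c ⟧ᶜ v
  rename-introᶜ (s ≐ t) h = subst₂ _≡_   (rename-evalₜ σ s (h ∘ inj₁)) (rename-evalₜ σ t (h ∘ inj₂))
  rename-introᶜ (s ≼ t) h = subst₂ ℤ._≤_ (rename-evalₜ σ s (h ∘ inj₁)) (rename-evalₜ σ t (h ∘ inj₂))
  rename-introᶜ (s ≺ t) h = subst₂ ℤ._<_ (rename-evalₜ σ s (h ∘ inj₁)) (rename-evalₜ σ t (h ∘ inj₂))

  rename-elimᶜ : ∀ c → (∀ {z} → fvᶜ c z → u z ≡ v (σ z)) →
                 ⟦ renameᶜ σ c ⟧ᶜ v → ⟦ c ⟧ᶜ u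
  rename-elimᶜ (s ≐ t) h = subst₂ _≡_   (sym (rename-evalₜ σ s (h ∘ inj₁)))
      (sym (rename-evalₜ σ t (h ∘ inj₂)))
  rename-elimᶜ (s ≼ t) h = subst₂ ℤ._≤_ (sym (rename-evalₜ σ s (h ∘ inj₁)))
      (sym (rename-evalₜ σ t (h ∘ inj₂)))
  rename-elimᶜ (s ≺ t) h = subst₂ ℤ._<_ (sym (rename-evalₜ σ s (h ∘ inj₁)))
      (sym (rename-evalₜ σ t (h ∘ inj₂)))

  -- Negation swaps the two directions, so they are proved by mutual recursion. Agreement is asked
  -- only on free variables: the models that get glued match nowhere else in general.
  rename-intro : ∀ ψ → (∀ {z} → fv ψ z → u z ≡ v (σ z)) → ⟦ ψ ⟧ u → ⟦ rename σ ψ ⟧ v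
  rename-elim  : ∀ ψ → (∀ {z} → fv ψ z → u z ≡ v (σ z)) → ⟦ rename σ ψ ⟧ v → ⟦ ψ ⟧ u

  rename-intro (atom c) h p = rename-introᶜ c h p
  rename-intro ⊤        h p = p
  rename-intro (~ ψ)    h p = p ∘ rename-elim ψ h
  rename-intro (ψ ∧ χ)  h (p , q) = rename-intro ψ (h ∘ inj₁) p , rename-intro χ (h ∘ inj₂) q
  rename-intro (ψ ∨ χ)  h = Sum.map (rename-intro ψ (h ∘ inj₁)) (rename-intro χ (h ∘ inj₂))

  rename-elim (atom c) h p = rename-elimᶜ c h p
  rename-elim ⊤        h p = p
  rename-elim (~ ψ)    h p = p ∘ rename-intro ψ h
  rename-elim (ψ ∧ χ)  h (p , q) = rename-elim ψ (h ∘ inj₁) p , rename-elim χ (h ∘ inj₂) q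
  rename-elim (ψ ∨ χ)  h = Sum.map (rename-elim ψ (h ∘ inj₁)) (rename-elim χ (h ∘ inj₂))

-- Decidability of occurrence, and values of a substitution.

module _ (_≟_ : DecidableEquality V) where

  fvₜ? : ∀ t → Decidable (fvₜ {V} t)
  fvₜ? (var x)   z = x ≟ z
  fvₜ? (const c) z = no λ ()
  fvₜ? (s ⊕ t)   z = fvₜ? s z ⊎-dec fvₜ? t z
  fvₜ? (c · t)   z = fvₜ? t z

  fvᶜ? : ∀ c → Decidable (fvᶜ {V} c)
  fvᶜ? (s ≐ t) z = fvₜ? s z ⊎-dec fvₜ? t z
  fvᶜ? (s ≼ t) z = fvₜ? s z ⊎-dec fvₜ? t z
  fvᶜ? (s ≺ t) z = fvₜ? s z ⊎-dec fvₜ? t z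

  fv? : ∀ ψ → Decidable (fv {V} ψ)
  fv? (atom c) z = fvᶜ? c z
  fv? ⊤        z = no λ ()
  fv? ⊥        z = no λ ()
  fv? (~ ψ)    z = fv? ψ z
  fv? (ψ ∧ χ)  z = fv? ψ z ⊎-dec fv? χ z
  fv? (ψ ∨ χ)  z = fv? ψ z ⊎-dec fv? χ z

  Range? : (xs : Vector V n) → Decidable (Range xs)
  Range? xs z = any? λ i → xs i ≟ z

  open Substitution _≟_

  -- The search may stop at any index carrying the name `ps i`; injectivity identifies that index
  -- with `i`.
  ←-at : {ps xs : Vector V n} → Injective _≡_ _≡_ ps → ∀ i → [ ps ← xs ] (ps i) ≡ xs i
  ←-at {ps = ps} {xs} inj i with any? (λ i′ → ps i′ ≟ ps i)
  ... | yes (i′ , eq) = cong xs (inj eq)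
  ... | no  ∉ps       = ⊥-elim (∉ps (i , refl))

  ←-off : {ps xs : Vector V n} {z : V} → z ∉ Range ps → [ ps ← xs ] z ≡ z
  ←-off {ps = ps} {z = z} ∉ps with any? (λ i → ps i ≟ z)
  ... | yes ∈ps = ⊥-elim (∉ps ∈ps)
  ... | no  _   = refl

-- Valuations: agreement with markings, and overriding.

infix 4 _on_≗_
_on_≗_ : Valuation V → Vector V n → Vector ℕ n → Set
v on z ≗ m = ∀ i → v (z i) ≡ + m i

⌜⌝-intro : (m : Vector ℕ n) (z : Vector V n) → v on z ≗ m → ⟦ ⌜ m ⌝ z ⟧ v
⌜⌝-intro m z = ⋀-intro λ i → atom (var (z i) ≐ const (+ m i))

⌜⌝-elim : (m : Vector ℕ n) (z : Vector V n) → ⟦ ⌜ m ⌝ z ⟧ v → v on z ≗ m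
⌜⌝-elim m z = ⋀-elim λ i → atom (var (z i) ≐ const (+ m i))

module _ (v : Valuation V) (z : Vector V k) (z′ : Vector V l)
         {m : Vector ℕ k} {m′ : Vector ℕ l} where

  on-++ : v on z ≗ m → v on z′ ≗ m′ → v on z ++ z′ ≗ m ++ m′
  on-++ h h′ i with splitAt k i
  ... | inj₁ i₁ = h i₁
  ... | inj₂ i₂ = h′ i₂

  on-++ˡ : v on z ++ z′ ≗ m ++ m′ → v on z ≗ m
  on-++ˡ h i =
    subst₂ (λ p a → v p ≡ + a) (lookup-++ˡ z z′ i) (lookup-++ˡ m m′ i) (h (i ↑ˡ l))

  on-++ʳ : v on z ++ z′ ≗ m ++ m′ → v on z′ ≗ m′
  on-++ʳ h i =
    subst₂ (λ p a → v p ≡ + a) (lookup-++ʳ z z′ i) (lookup-++ʳ m m′ i) (h (k ↑ʳ i))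

module _ (N₁ N₂ : LabeledNet V L) (E : System V) {m₁ : Marking N₁} {m₂ : Marking N₂} where

  Joint⊨-intro : ∀ v → Compatible N₁ N₂ m₁ m₂ → ⟦ conj E ⟧ v →
                 v on place N₁ ≗ m₁ → v on place N₂ ≗ m₂ → Joint⊨ N₁ N₂ E m₁ m₂
  Joint⊨-intro v c e h₁ h₂ =
    c , v , e , ⌜⌝-intro (m₁ ++ m₂) (place N₁ ++ place N₂) (on-++ v (place N₁) (place N₂) h₁ h₂)

  Joint⊨-elim : Joint⊨ N₁ N₂ E m₁ m₂ →
                Compatible N₁ N₂ m₁ m₂ ×
                ∃[ v ] ⟦ conj E ⟧ v × v on place N₁ ≗ m₁ × v on place N₂ ≗ m₂
  Joint⊨-elim (c , v , e , h) =
    c , v , e , on-++ˡ v (place N₁) (place N₂) on , on-++ʳ v (place N₁) (place N₂) on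
    where on = ⌜⌝-elim (m₁ ++ m₂) (place N₁ ++ place N₂) h

-- The overridden variables are the image of an arbitrary index type, which covers both a vector
-- such as `x` and a family indexed by pairs such as `ys`.
override : {f : A → V} → Decidable (λ z → ∃[ a ] f a ≡ z) → (A → ℤ) → Valuation V → Valuation V
override ∈f? g v z with ∈f? z
... | yes (a , _) = g a
... | no  _       = v z

override-at : {f : A → V} (∈f? : Decidable (λ z → ∃[ a ] f a ≡ z)) {g : A → ℤ} →
              Injective _≡_ _≡_ f → ∀ a → override ∈f? g v (f a) ≡ g a
override-at {f = f} ∈f? {g} inj a with ∈f? (f a)
... | yes (a′ , eq) = cong g (inj eq)
... | no  ∉f        = ⊥-elim (∉f (a , refl))

override-off : {f : A → V} (∈f? : Decidable (λ z → ∃[ a ] f a ≡ z)) {g : A → ℤ} {z : V} →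
               ¬ (∃[ a ] f a ≡ z) → override ∈f? g v z ≡ v z
override-off ∈f? {z = z} ∉f with ∈f? z
... | yes ∈f = ⊥-elim (∉f ∈f)
... | no  _  = refl

-- Runs of a net and models of the bounded model checking formulas.

+-fire : ∀ {a p} q → p ≤ a → + (a ∸ p + q) ≡ + a ℤ.+ (+ q ℤ.- + p)
+-fire {a} {p} q p≤a = begin
  -- Since `p ≤ a`, the truncated difference is the integer one; what remains is rearrangement.
  + (a ∸ p) ℤ.+ + q         ≡⟨ cong (ℤ._+ + q) (sym (ℤ.⊖-≥ p≤a)) ⟩
  (a ℤ.⊖ p) ℤ.+ + q         ≡⟨ cong (ℤ._+ + q) (sym (ℤ.m-n≡m⊖n a p)) ⟩
  + a ℤ.+ ℤ.- + p ℤ.+ + q   ≡⟨ ℤ.+-assoc (+ a) (ℤ.- + p) (+ q) ⟩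
  + a ℤ.+ (ℤ.- + p ℤ.+ + q) ≡⟨ cong (ℤ._+_ (+ a)) (ℤ.+-comm (ℤ.- + p) (+ q)) ⟩
  + a ℤ.+ (+ q ℤ.- + p)     ∎

module _ (N : LabeledNet V L) where
  open LabeledNet N hiding (#P; place; Marking)

  -- The relation on markings that `T` expresses: one firing, or stuttering.
  data Step (m m′ : Marking N) : Set where
    stay : m ≗ m′ → Step m m′
    fire : ∀ t → m —[ t ]→ m′ → Step m m′

  →-respˡ : ∀ {m m′ m″ t} → m ≗ m′ → m′ —[ t ]→ m″ → m —[ t ]→ m″
  →-respˡ {t = t} eq (en , δ) =
    (λ p → subst (Pre t p ≤_) (sym (eq p)) (en p)) ,
    (λ p → trans (δ p) (cong (λ a → a ∸ Pre t p + Post t p) (sym (eq p))))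

  ⟹-respʳ : ∀ {m m′ m″ ϱ} → m ⟹[ ϱ ] m′ → m′ ≗ m″ → m ⟹[ ϱ ] m″
  ⟹-respʳ (ε eq)  eq′ = ε λ p → trans (eq p) (eq′ p)
  ⟹-respʳ (s ◅ r) eq′ = s ◅ ⟹-respʳ r eq′

  -- Runs grow at the front while `φ` is unrolled at the back; reading a run off a model of `φ`
  -- therefore appends transitions.
  ⟹-snoc : ∀ {m m′ m″ ϱ t} → m ⟹[ ϱ ] m′ → m′ —[ t ]→ m″ → m ⟹[ ϱ ∷ʳ t ] m″
  ⟹-snoc (ε eq)  s = →-respˡ eq s ◅ ε λ _ → refl
  ⟹-snoc (s ◅ r) s′ = s ◅ ⟹-snoc r s′

  R-step : ∀ {m₀ m m′} → R (N , m₀) m → Step m m′ → R (N , m₀) m′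
  R-step (ϱ , r) (stay eq)  = ϱ , ⟹-respʳ r eq
  R-step (ϱ , r) (fire t s) = ϱ ∷ʳ t , ⟹-snoc r s

  -- Total on the naturals: past the end of the run its last marking repeats, which counts as
  -- stuttering. In the empty run this is the left endpoint, so the right one is met only pointwise.
  trace : ∀ {m m′ ϱ} → m ⟹[ ϱ ] m′ → ℕ → Marking N
  trace {m} (ε _)   i       = m
  trace {m} (_ ◅ _) zero    = m
  trace     (_ ◅ r) (suc i) = trace r i

  trace-zero : ∀ {m m′ ϱ} (r : m ⟹[ ϱ ] m′) → trace r 0 ≡ m
  trace-zero (ε _)   = refl
  trace-zero (_ ◅ _) = refl

  trace-step : ∀ {m m′ ϱ} (r : m ⟹[ ϱ ] m′) i → Step (trace r i) (trace r (suc i))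
  trace-step     (ε _)   i       = stay λ _ → refl
  -- `trace r 0` reduces only after `r` is split, hence the transport.
  trace-step {m} (s ◅ r) zero    = subst (Step m) (sym (trace-zero r)) (fire _ s)
  trace-step     (_ ◅ r) (suc i) = trace-step r i

  trace-length : ∀ {m m′ ϱ} (r : m ⟹[ ϱ ] m′) → trace r (length ϱ) ≗ m′
  trace-length (ε eq)  = eq
  trace-length (_ ◅ r) = trace-length r

  module _ (z z′ : Vector V (#P N)) where

    private
      effect : Transition → Fin (#P N) → ℤ
      effect t i = + Post t i ℤ.- + Pre t i

      Firing : Transition → Formula V
      Firing t = ENBL N t z ∧ Δ N t z z′

    T-intro : ∀ {m m′} → v on z ≗ m → v on z′ ≗ m′ → Step m m′ → ⟦ T N z z′ ⟧ v
    T-intro h h′ (stay eq) =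
      inj₁ (⋀-intro _ λ i → trans (h i) (trans (cong +_ (eq i)) (sym (h′ i))))
    T-intro {v = v} {m} {m′} h h′ (fire t (en , δ)) = inj₂ (⋁-intro Firing (t ,
      ⋀-intro _ (λ i → subst (+ Pre t i ℤ.≤_) (sym (h i)) (ℤ.+≤+ (en i))) ,
      ⋀-intro _ λ i → begin
        v (z′ i)                        ≡⟨ h′ i ⟩
        + m′ i                          ≡⟨ cong +_ (δ i) ⟩
        + (m i ∸ Pre t i + Post t i)    ≡⟨ +-fire (Post t i) (en i) ⟩
        + m i ℤ.+ effect t i            ≡⟨ cong (ℤ._+ effect t i) (h i) ⟨
        v (z i) ℤ.+ effect t i          ∎))

    -- The values at `z′` are natural numbers again: stuttering copies those of `m`, and a firing
    -- subtracts no more than `m` holds, by `ENBL`. This is what keeps every `y i` nonnegative along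
    -- a model of `φ`.
    T-elim : ∀ {m} → v on z ≗ m → ⟦ T N z z′ ⟧ v → ∃[ m′ ] Step m m′ × v on z′ ≗ m′
    T-elim {m = m} h (inj₁ eq) = m , stay (λ _ → refl) , λ i →
      trans (sym (⋀-elim (λ i → atom (var (z i) ≐ var (z′ i))) eq i)) (h i)
    T-elim {v = v} {m} h (inj₂ tr) with ⋁-elim Firing tr
    ... | t , enbl , δ = _ , fire t (en , λ _ → refl) , λ i → begin
      v (z′ i)                     ≡⟨ ⋀-elim (λ i → atom (var (z′ i) ≐ var (z i) ⊕ const (effect t i))) δ i ⟩
      v (z i) ℤ.+ effect t i       ≡⟨ cong (ℤ._+ effect t i) (h i) ⟩
      + m i ℤ.+ effect t i         ≡⟨ +-fire (Post t i) (en i) ⟨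
      + (m i ∸ Pre t i + Post t i) ∎
      where
      en : Enabled m t
      en i = ℤ.drop‿+≤+ (subst (+ Pre t i ℤ.≤_) (h i)
               (⋀-elim (λ i → atom (var (z i) ≽ const (+ Pre t i))) enbl i))

  module _ {m₀ : Marking N} (y : ℕ → Vector V (#P N)) where

    -- Agreement is required only up to `j`, because the glued valuation controls only `y 0` to
    -- `y j`.
    φ-intro : {s : ℕ → Marking N} → s 0 ≡ m₀ → (∀ i → Step (s i) (s (suc i))) →
              ∀ j → (∀ {i} → i ≤ j → v on y i ≗ s i) → ⟦ φ (N , m₀) y j ⟧ v
    φ-intro refl st zero    h = ⌜⌝-intro m₀ (y 0) (h z≤n)
    φ-intro refl st (suc j) h =
      φ-intro refl st j (h ∘ ℕ.m≤n⇒m≤1+n) ,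
      T-intro (y j) (y (suc j)) (h (ℕ.n≤1+n j)) (h ℕ.≤-refl) (st j)

    φ-elim : ∀ j → ⟦ φ (N , m₀) y j ⟧ v → ∃[ m ] R (N , m₀) m × v on y j ≗ m
    φ-elim zero    h = m₀ , ([] , ε λ _ → refl) , ⌜⌝-elim m₀ (y 0) h
    φ-elim (suc j) (h , tr) with φ-elim j h
    ... | m , r , on with T-elim (y j) (y (suc j)) on tr
    ... | m′ , st , on′ = m′ , R-step r st , on′

-- Models of the relation `Ẽ` and jointly satisfying markings.

module _ (_≟_ : DecidableEquality V) (N₁ N₂ : LabeledNet V L) (E : System V) (F₁ : Formula V)
  where

  open Substitution _≟_

  private
    P₁ = place N₁
    P₂ = place N₂

  module _ {x : Vector V (#P N₁)} {y : ℕ → Vector V (#P N₂)}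
    (fresh : Fresh (Range P₁ ∪ Range P₂ ∪ fv (conj E) ∪ fv F₁) x y) where

    open Fresh fresh

    x∉P₂ : ∀ i → x i ∉ Range P₂
    x∉P₂ i ∈P₂ = x-fresh ((i , refl) , inj₂ (inj₁ ∈P₂))

    -- The second substitution leaves `x i` alone, since the fresh `x i` is no place of `N₂`.
    ←-P₁ : ∀ {y′} i → [ P₂ ← y′ ] ([ P₁ ← x ] (P₁ i)) ≡ x i
    ←-P₁ {y′} i = trans (cong [ P₂ ← y′ ] (←-at _≟_ (LabeledNet.place-inj N₁) i))
                        (←-off _≟_ (x∉P₂ i))

    -- A shared place is already sent to `x` by the first substitution; only places outside `P₁`
    -- reach the second.
    ←-P₂ : ∀ {y′ i} → P₂ i ∉ Range P₁ → [ P₂ ← y′ ] ([ P₁ ← x ] (P₂ i)) ≡ y′ i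
    ←-P₂ {y′} {i} ∉P₁ = trans (cong [ P₂ ← y′ ] (←-off _≟_ ∉P₁))
                              (←-at _≟_ (LabeledNet.place-inj N₂) i)

    -- Pulling `v` back along both substitutions gives the model of `E`. The markings come out in
    -- the order that `N₂ ⊒ N₁` consumes.
    Ẽ-elim : ∀ {y′ m m′} → v on x ≗ m → v on y′ ≗ m′ →
             ⟦ Ẽ _≟_ N₁ N₂ E x y′ ⟧ v → Joint⊨ N₂ N₁ E m′ m
    Ẽ-elim {v = v} {y′} {m} {m′} onˣ onʸ (e , sh) =
      Joint⊨-intro N₂ N₁ E (v ∘ [ P₂ ← y′ ] ∘ [ P₁ ← x ]) compatible
        (rename-elim [ P₁ ← x ] (conj E) (λ _ → refl)
          (rename-elim [ P₂ ← y′ ] (conj E ⟪ P₁ ← x ⟫) (λ _ → refl) e))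
        on₂ on₁
      where
      shared-atom : Vector (Vector (Formula V) (#P N₂)) (#P N₁)
      shared-atom i j = if ⌊ P₁ i ≟ P₂ j ⌋ then atom (var (x i) ≐ var (y′ j)) else ⊤

      shared : ∀ {i j} → P₁ i ≡ P₂ j → v (x i) ≡ v (y′ j)
      shared {i} {j} = guard-elim (P₁ i ≟ P₂ j) _
        (⋀-elim (shared-atom i) (⋀-elim (⋀ ∘ shared-atom) sh i) j)

      compatible : Compatible N₂ N₁ m′ m
      compatible j i eq =
        ℤ.+-injective (trans (sym (onʸ j)) (trans (sym (shared (sym eq))) (onˣ i)))

      on₁ : v ∘ [ P₂ ← y′ ] ∘ [ P₁ ← x ] on P₁ ≗ m
      on₁ i = trans (cong v (←-P₁ i)) (onˣ i)

      on₂ : v ∘ [ P₂ ← y′ ] ∘ [ P₁ ← x ] on P₂ ≗ m′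
      on₂ j = case Range? _≟_ P₁ (P₂ j) of λ where
        (no  ∉P₁)      → trans (cong v (←-P₂ ∉P₁)) (onʸ j)
        -- A shared place was renamed to `x i`, so its value at `y′ j` comes from the equation that
        -- `Ẽ` adds for shared places.
        (yes (i , eq)) → begin
          v ([ P₂ ← y′ ] ([ P₁ ← x ] (P₂ j))) ≡⟨ cong (v ∘ [ P₂ ← y′ ] ∘ [ P₁ ← x ]) eq ⟨
          v ([ P₂ ← y′ ] ([ P₁ ← x ] (P₁ i))) ≡⟨ cong v (←-P₁ i) ⟩
          v (x i)                             ≡⟨ shared eq ⟩
          v (y′ j)                            ≡⟨ onʸ j ⟩
          + m′ j                              ∎

    -- Places of either net get their values from `m` and `m′`, so `u` and `v` need to agree only on
    -- the variables of `E` that are no places.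
    Ẽ-intro : ∀ {y′ m m′} → v on x ≗ m → v on y′ ≗ m′ → Compatible N₁ N₂ m m′ →
              ⟦ conj E ⟧ u → u on P₁ ≗ m → u on P₂ ≗ m′ →
              (∀ {z} → (fv (conj E) ∖ Range P₁) z → z ∉ Range P₂ → u z ≡ v z) →
              ⟦ Ẽ _≟_ N₁ N₂ E x y′ ⟧ v
    Ẽ-intro {v = v} {u = u} {y′} onˣ onʸ c e on₁ on₂ agree =
      rename-intro [ P₂ ← y′ ] (conj E ⟪ P₁ ← x ⟫) (λ _ → refl)
        (rename-intro [ P₁ ← x ] (conj E) value e) ,
      ⋀-intro _ λ i → ⋀-intro _ λ j → guard-intro (P₁ i ≟ P₂ j) _ λ eq →
        trans (onˣ i) (trans (cong +_ (c i j eq)) (sym (onʸ j)))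
      where
      value : ∀ {z} → fv (conj E) z → u z ≡ v ([ P₂ ← y′ ] ([ P₁ ← x ] z))
      value {z} ∈E = case Range? _≟_ P₁ z ,′ Range? _≟_ P₂ z of λ where
        (yes (i , refl) , _) → trans (on₁ i) (sym (trans (cong v (←-P₁ i)) (onˣ i)))
        (no ∉P₁ , yes (j , refl)) → trans (on₂ j) (sym (trans (cong v (←-P₂ ∉P₁)) (onʸ j)))
        (no ∉P₁ , no ∉P₂) → trans (agree (∈E , ∉P₁) ∉P₂) (cong v (sym
          (trans (cong [ P₂ ← y′ ] (←-off _≟_ ∉P₁)) (←-off _≟_ ∉P₂))))

    -- Gluing models of `F₁` and `E` with a sequence of markings.

    module Glue (disjoint : Empty ((fv F₁ ∖ Range P₁) ∩ (fv (conj E) ∖ Range P₁)))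
      (f e : Valuation V) (m : Marking N₁) (s : ℕ → Marking N₂) (j : ℕ) where

      -- Only y 0, …, y j are overridden, so that membership is decidable.
      ys : Fin (suc j) × Fin (#P N₂) → V
      ys (i , p) = y (toℕ i) p

      ys-injective : Injective _≡_ _≡_ ys
      ys-injective {i , p} {i′ , p′} eq with y-distinct {toℕ i , p} {toℕ i′ , p′} eq
      ... | eq′ = cong₂ _,_ (toℕ-injective (,-injectiveˡ eq′)) (,-injectiveʳ eq′)

      ys? : Decidable (λ z → ∃[ a ] ys a ≡ z)
      ys? z = map′ (λ (i , p , eq) → (i , p) , eq) (λ ((i , p) , eq) → i , p , eq)
                   (any? λ i → Range? _≟_ (y (toℕ i)) z)

      -- Priority of `f` over `e` is harmless: a variable common to `F₁` and `E` is a place of `N₁`,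
      -- and `Ẽ` replaces those by `x`.
      base onY glued : Valuation V
      base z with fv? _≟_ F₁ z
      ... | yes _ = f z
      ... | no  _ = e z
      onY   = override ys? (λ (i , p) → + s (toℕ i) p) base
      glued = override (Range? _≟_ x) (λ i → + m i) onY

      glued-x : glued on x ≗ m
      glued-x = override-at (Range? _≟_ x) x-distinct

      glued-y : ∀ {i} → i ≤ j → glued on y i ≗ s i
      glued-y {i} i≤j p =
        trans (override-off (Range? _≟_ x) λ ∈x → x-y i (∈x , p , refl))
              -- The bound `i ≤ j` makes `i` an element of `Fin (suc j)`; the transport undoes that
              -- encoding.
              (subst (λ i′ → onY (y i′ p) ≡ + s i′ p) (toℕ-fromℕ< (s≤s i≤j))
                     (override-at ys? ys-injective (fromℕ< (s≤s i≤j) , p)))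

      -- Both overrides touch fresh variables only.
      glued-used : ∀ {z} → (Range P₁ ∪ Range P₂ ∪ fv (conj E) ∪ fv F₁) z → glued z ≡ base z
      glued-used used =
        trans (override-off (Range? _≟_ x) λ ∈x → x-fresh (∈x , used))
              (override-off ys? λ ((i , p) , eq) → y-fresh (toℕ i) ((p , eq) , used))

      glued-F₁ : ∀ {z} → fv F₁ z → f z ≡ glued z
      glued-F₁ {z} ∈F₁ = sym (trans (glued-used (inj₂ (inj₂ (inj₂ ∈F₁)))) eq)
        where
        eq : base z ≡ f z
        eq with fv? _≟_ F₁ z
        ... | yes _   = refl
        ... | no ∉F₁  = ⊥-elim (∉F₁ ∈F₁)

      glued-E : ∀ {z} → (fv (conj E) ∖ Range P₁) z → e z ≡ glued z
      glued-E {z} (∈E , ∉P₁) = sym (trans (glued-used (inj₂ (inj₂ (inj₁ ∈E)))) eq)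
        where
        eq : base z ≡ e z
        eq with fv? _≟_ F₁ z
        -- Outside `P₁` a variable of `E` cannot occur in `F₁`: this is the hypothesis `disjoint`.
        ... | yes ∈F₁ = ⊥-elim (disjoint z ((∈F₁ , ∉P₁) , ∈E , ∉P₁))
        ... | no _    = refl

-- The two directions of the equivalence.

theorem6 : {V L : Set} (_≟_ : DecidableEquality V)
    (N₁ N₂ : LabeledNet V L) (m₁ : Marking N₁) (m₂ : Marking N₂)
    (E : System V) → (N₁ , m₁) ▷[ E ] (N₂ , m₂) →
    (F₁ : Formula V) →
    Empty ((fv F₁ ∖ Range (place N₁)) ∩ (fv (conj E) ∖ Range (place N₁))) →
    (x : Vector V (#P N₁)) (y : ℕ → Vector V (#P N₂)) →
    Fresh (Range (place N₁) ∪ Range (place N₂) ∪ fv (conj E) ∪ fv F₁) x y →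
    ReachableFormula F₁ (N₁ , m₁)
    ⇔ (∃[ j ] Satisfiable ⟦ E-transform _≟_ N₁ N₂ E F₁ x (y j) ∧′ qf (φ (N₂ , m₂) y j) ⟧∃)
theorem6 {V} _≟_ N₁ N₂ m₁ m₂ E (N₁⊒N₂ , N₂⊒N₁) F₁ disjoint x y fresh = mk⇔ to from
  where
  open Substitution _≟_
  open Fresh fresh
  P₁ = place N₁

  Bounded : Set
  Bounded =
    ∃[ j ] Satisfiable ⟦ E-transform _≟_ N₁ N₂ E F₁ x (y j) ∧′ qf (φ (N₂ , m₂) y j) ⟧∃

  to : ReachableFormula F₁ (N₁ , m₁) → Bounded
  to (m , (ϱ , r) , f , ⊨F₁ , ⊨m) with _⊒[_]_.A2∃ N₁⊒N₂ r
  ... | m′ , joint with _⊒[_]_.A2∀ N₁⊒N₂ r m′ joint | Joint⊨-elim N₁ N₂ E joint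
  ... | ϱ′ , r′ , _ | c , e , ⊨E , on₁ , on₂ =
    j , glued ,
    -- `glued` already gives `x` the values of `m`, so it is its own witness for the quantifier.
    (glued , (λ _ _ → refl) ,
      ⋀-intro _ (λ i → subst (0ℤ ℤ.≤_) (sym (glued-x i)) (ℤ.+≤+ z≤n)) ,
      Ẽ-intro _≟_ N₁ N₂ E F₁ fresh glued-x
        (λ p → trans (glued-y ℕ.≤-refl p) (cong +_ (trace-length N₂ r′ p)))
        c ⊨E on₁ on₂ (λ ∈E _ → glued-E ∈E) ,
      rename-intro [ P₁ ← x ] F₁ value ⊨F₁) ,
    φ-intro N₂ y (trace-zero N₂ r′) (trace-step N₂ r′) j glued-y
    where
    j = length ϱ′
    open Glue _≟_ N₁ N₂ E F₁ fresh disjoint f e m (trace N₂ r′) j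

    value : ∀ {z} → fv F₁ z → f z ≡ glued ([ P₁ ← x ] z)
    value {z} ∈F₁ = case Range? _≟_ P₁ z of λ where
      (yes (i , refl)) → trans (⌜⌝-elim m P₁ ⊨m i)
        (sym (trans (cong glued (←-at _≟_ (LabeledNet.place-inj N₁) i)) (glued-x i)))
      (no ∉P₁) → trans (glued-F₁ ∈F₁) (cong glued (sym (←-off _≟_ ∉P₁)))

  -- The marking of `N₁` to be reached, read off `x`. Under the sign conjunct of the E-transform the
  -- absolute value changes nothing.
  ∣_∣ˣ : Valuation V → Marking N₁
  ∣ w ∣ˣ i = ∣ w (x i) ∣

  onˣ : ∀ w → ⟦ ⋀ (λ i → atom (var (x i) ≽ const 0ℤ)) ⟧ w → w on x ≗ ∣ w ∣ˣ
  onˣ w x≥0 i = sym (ℤ.0≤i⇒+∣i∣≡i (⋀-elim (λ i → atom (var (x i) ≽ const 0ℤ)) x≥0 i))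

  from : Bounded → ReachableFormula F₁ (N₁ , m₁)
  from (j , v , (w , w≡v , x≥0 , ẽ , ⊨F₁) , ⊨φ) with φ-elim N₂ y j ⊨φ
  ... | m′ , (ϱ′ , r′) , onʸ
    with _⊒[_]_.A2∀ N₂⊒N₁ r′ ∣ w ∣ˣ (Ẽ-elim _≟_ N₁ N₂ E F₁ fresh (onˣ w x≥0)
           -- The witness `w` may differ from `v` only on `x`, which is disjoint from `y j`, so it
           -- still shows `m′` there.
           (λ p → trans (w≡v (y j p) λ ∈x → x-y j (∈x , p , refl)) (onʸ p)) ẽ)
  -- The model of `F₁` is `w` pulled back along the substitution, which moves the values of `x` to
  -- the places of `N₁`.
  ... | ϱ , r , _ = ∣ w ∣ˣ , (ϱ , r) , w ∘ [ P₁ ← x ] ,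
    rename-elim [ P₁ ← x ] F₁ (λ _ → refl) ⊨F₁ ,
    ⌜⌝-intro ∣ w ∣ˣ P₁ λ i →
      trans (cong w (←-at _≟_ (LabeledNet.place-inj N₁) i)) (onˣ w x≥0 i)
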